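{- If $G$ is a finite simple undirected $P_6$-free graph that has an efficient dominating set, then its square $G^2$ is $C_k$-free for every $k\ge 5$.
   Context: All graphs are finite, undirected and simple. A vertex dominates itself and its neighbors. A set $D\subseteq V$ is an efficient dominating set of $G=(V,E)$ if every vertex of $G$ is dominated by exactly one vertex of $D$. The square $G^2=(V,E^2)$ has $uv\in E^2$ iff $d_G(u,v)\in\{1,2\}$. "$F$-free" means containing no induced subgraph isomorphic to $F$. $P_k$ (resp. $C_k$) is the chordless path (resp. cycle) on $k$ vertices. -}

module Defs where

open import Data.Fin.Base using (Fin; toℕ)
open import Data.Fin.Properties using (any?)
import Data.Fin.Properties as Fin
open import Data.Fin.Subset using (Subset; _∈_)
open import Data.Nat.Base using (ℕ; suc; _≤_; z≤n; s≤s)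
import Data.Nat.Properties as ℕ
open import Data.Product using (∃; ∃!; _×_; _,_; proj₁)
open import Data.Sum.Base using (_⊎_; inj₁; inj₂; swap)
import Data.Sum.Base as Sum
open import Function.Base using (_∘_)
open import Function.Bundles using (_↔_; _⇔_; Inverse)
open import Level using (0ℓ)
open import Relation.Binary.Core using (Rel)
open import Relation.Binary.Definitions using (Decidable; Irreflexive; Symmetric)
open import Relation.Binary.PropositionalEquality.Core using (_≡_; _≢_; refl)
open import Relation.Nullary.Decidable using (map′; _×-dec_; _⊎-dec_; ¬?)
open import Relation.Nullary.Negation using (¬_; contradiction)

private
  variable
    n : ℕ
    V W : Set

-- A finite graph is a Graph (Fin n).  A general vertex type is allowed so that
-- induced subgraphs are graphs too.  Decidability of adjacency is automatic
-- classically.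
record Graph (V : Set) : Set₁ where
  infix 4 _~_ _~?_
  field
    _~_    : Rel V 0ℓ
    _~?_   : Decidable _~_
    ~-sym  : Symmetric _~_
    irrefl : Irreflexive _≡_ _~_

infix 4 _≅_
record _≅_ (G : Graph V) (H : Graph W) : Set where
  private
    module G = Graph G
    module H = Graph H
  field
    bijection : V ↔ W
  open Inverse bijection using (to)
  field
    adjacency : ∀ u v → (u G.~ v) ⇔ (to u H.~ to v)

infix 8 _[_]
_[_] : Graph (Fin n) → (S : Subset n) → Graph (∃ λ x → x ∈ S)
G [ S ] = record
  { _~_    = λ u v → proj₁ u ~ proj₁ v
  ; _~?_   = λ u v → proj₁ u ~? proj₁ v
  ; ~-sym  = ~-sym
  ; irrefl = λ { refl → irrefl refl }
  }
  where open Graph G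

infix 4 _is_-free
_is_-free : Graph (Fin n) → Graph W → Set
G is F -free = ∀ S → ¬ (G [ S ] ≅ F)

P : (k : ℕ) → Graph (Fin k)
P k = record
  { _~_    = λ i j → suc (toℕ i) ≡ toℕ j ⊎ suc (toℕ j) ≡ toℕ i
  ; _~?_   = λ i j → (suc (toℕ i) ℕ.≟ toℕ j) ⊎-dec (suc (toℕ j) ℕ.≟ toℕ i)
  ; ~-sym  = swap
  ; irrefl = λ { refl (inj₁ e) → ℕ.1+n≢n e ; refl (inj₂ e) → ℕ.1+n≢n e }
  }

-- j is the successor of i modulo k.
Next : ∀ {k} → Rel (Fin k) 0ℓ
Next {k} i j = suc (toℕ i) ≡ toℕ j ⊎ (suc (toℕ i) ≡ k × toℕ j ≡ 0)

next? : ∀ {k} → Decidable (Next {k})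
next? {k} i j =
  (suc (toℕ i) ℕ.≟ toℕ j) ⊎-dec ((suc (toℕ i) ℕ.≟ k) ×-dec (toℕ j ℕ.≟ 0))

next-irrefl : ∀ {k} → 3 ≤ k → (i : Fin k) → ¬ Next i i
next-irrefl _   i (inj₁ e)        = ℕ.1+n≢n e
next-irrefl 3≤k i (inj₂ (e , e₀)) with toℕ i
next-irrefl (s≤s ()) i (inj₂ (refl , refl)) | .0

C : (k : ℕ) → 3 ≤ k → Graph (Fin k)
C k 3≤k = record
  { _~_    = λ i j → Next i j ⊎ Next j i
  ; _~?_   = λ i j → next? i j ⊎-dec next? j i
  ; ~-sym  = swap
  ; irrefl = λ { {i} refl (inj₁ e) → next-irrefl 3≤k i e
               ; {i} refl (inj₂ e) → next-irrefl 3≤k i e }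
  }

module _ (G : Graph V) where
  open Graph G

  Dominates : Rel V 0ℓ
  Dominates u v = u ≡ v ⊎ u ~ v

  infixr 5 _∷_

  data Walk : V → V → ℕ → Set where
    []  : ∀ {u} → Walk u u 0
    _∷_ : ∀ {u v w l} → u ~ v → Walk v w l → Walk u w (suc l)

  -- d_G(u,v) = d, as a relation since vertices may be disconnected.
  Distance : V → V → ℕ → Set
  Distance u v d = Walk u v d × (∀ {l} → Walk u v l → d ≤ l)

EfficientDominating : Graph (Fin n) → Subset n → Set
EfficientDominating G D = ∀ v → ∃! _≡_ λ d → d ∈ D × Dominates G d v

module _ (G : Graph V) where
  open Graph G

  snoc : ∀ {u v w l} → Walk G u v l → v ~ w → Walk G u w (suc l)
  snoc []       e = e ∷ []
  snoc (f ∷ fs) e = f ∷ snoc fs e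

  reverse : ∀ {u v l} → Walk G u v l → Walk G v u l
  reverse []       = []
  reverse (e ∷ es) = snoc (reverse es) (~-sym e)

  distance-sym : ∀ {u v d} → Distance G u v d → Distance G v u d
  distance-sym (p , shortest) = reverse p , shortest ∘ reverse

  distance₁⁺ : ∀ {u v} → u ~ v → Distance G u v 1
  distance₁⁺ e = e ∷ [] , λ { [] → contradiction e (irrefl refl) ; (_ ∷ _) → s≤s z≤n }

  distance₁⁻ : ∀ {u v} → Distance G u v 1 → u ~ v
  distance₁⁻ (e ∷ [] , _) = e

  distance₂⁺ : ∀ {u v} → u ≢ v × ¬ (u ~ v) × ∃ (λ w → u ~ w × w ~ v) → Distance G u v 2
  distance₂⁺ (u≢v , u≁v , _ , e , f) = e ∷ f ∷ [] , λ
    { []           → contradiction refl u≢v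
    ; (g ∷ [])     → contradiction g u≁v
    ; (_ ∷ _ ∷ _) → s≤s (s≤s z≤n)
    }

  distance₂⁻ : ∀ {u v} → Distance G u v 2 → u ≢ v × ¬ (u ~ v) × ∃ (λ w → u ~ w × w ~ v)
  distance₂⁻ (e ∷ f ∷ [] , shortest) =
    (λ { refl → contradiction (shortest []) λ () }) ,
    (λ g → contradiction (shortest (g ∷ [])) λ { (s≤s ()) }) ,
    _ , e , f

infix 9 _²
_² : Graph (Fin n) → Graph (Fin n)
G ² = record
  { _~_    = λ u v → Distance G u v 1 ⊎ Distance G u v 2
  ; _~?_   = λ u v →
      map′ (distance₁⁺ G) (distance₁⁻ G) (u ~? v)
      ⊎-dec
      map′ (distance₂⁺ G) (distance₂⁻ G)
        (¬? (u Fin.≟ v) ×-dec ¬? (u ~? v) ×-dec any? λ w → (u ~? w) ×-dec (w ~? v))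
  ; ~-sym  = Sum.map (distance-sym G) (distance-sym G)
  ; irrefl = λ { refl (inj₁ (_ , shortest)) → contradiction (shortest []) λ ()
               ; refl (inj₂ (_ , shortest)) → contradiction (shortest []) λ () }
  }
  where open Graph G

module Submission where

-- Unroll an induced cycle of length at least 5 in G² into an infinite periodic sequence v₀, v₁, …  Successive
-- vertices are adjacent or have a common neighbour xᵢ, while vertices at index distance 2 or 3 are at distance
-- at least 3 in G.  Let dᵢ be the vertex of D dominating vᵢ.  Looking for induced P₆'s among six successive
-- vertices with their xᵢ and dᵢ, one excludes in turn: an edge vᵢvᵢ₊₁; a vertex vᵢ in D; a coincidence
-- dᵢ = dᵢ₊₁.  In the remaining case every dᵢ is adjacent to xᵢ and, by symmetry, every dᵢ₊₁ is as well, so xᵢ is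
-- dominated twice.
--
-- The case distinctions are terms of a small language of refutations, which a checker turns into proofs.

open import Defs
open import Data.Empty using (⊥; ⊥-elim)
open import Data.Fin.Base using (Fin; zero; suc; toℕ)
open import Data.Fin.Properties using (all?; any?)
import Data.Fin.Properties as Fin
open import Data.Fin.Subset using (Subset; _∈_)
open import Data.List.Base using (List; []; _∷_; concatMap; upTo)
open import Data.List.Relation.Unary.All using (All; []; _∷_)
import Data.List.Relation.Unary.All as All
import Data.List.Relation.Unary.All.Properties as All
open import Data.Maybe.Base using (Maybe; just; nothing; _<∣>_; from-just; zipWith)
import Data.Maybe.Base as Maybe
open import Data.Nat.Base using (ℕ; zero; suc; _+_; _*_; _≤_; _<_; NonZero)
open import Data.Nat.DivMod
  using (_%_; _/_; _mod_; m≡m%n+[m/n]*n; [m+kn]%n≡m%n; m%n<n; m<n⇒m%n≡m; n%n≡0; m%n%n≡m%n)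
open import Data.Nat.Divisibility using (divides; ∣m+n∣m⇒∣n; >⇒∤)
open import Data.Nat.Properties using (≤-trans; m≤m+n)
import Data.Nat.Properties as ℕ
open import Data.Product.Base using (∃; _×_; _,_; proj₁; proj₂)
open import Data.Sum.Base using (_⊎_; inj₁; inj₂; [_,_]′)
open import Data.Vec.Base using (Vec; []; _∷_; lookup; tabulate)
open import Data.Vec.Properties using (lookup∘tabulate; lookup⇒[]=; []=⇒lookup)
open import Data.Vec.Properties.WithK using ([]=-irrelevant)
open import Function.Base using (_∘_; id)
open import Function.Bundles using (Inverse; Equivalence; _⇔_; mk⇔; mk↔ₛ′)
open import Function.Definitions using (Injective)
open import Relation.Binary.Definitions using (DecidableEquality)
open import Relation.Binary.PropositionalEquality
  using (_≡_; _≢_; refl; sym; trans; cong; subst; subst₂; module ≡-Reasoning)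
open import Relation.Nullary.Decidable
  using (Dec; yes; no; does; dec-true; dec⇒maybe; decidable-stable; from-yes; toSum; map′; _×-dec_; _→-dec_)
open import Relation.Nullary.Negation using (¬_)

-- Induced copies of P₆ given by vertex maps.

∈-≡ : ∀ {n} {S : Subset n} {y z : ∃ (_∈ S)} → proj₁ y ≡ proj₁ z → y ≡ z
∈-≡ {y = _ , y∈S} {z = _ , z∈S} refl = cong (_ ,_) ([]=-irrelevant y∈S z∈S)

induced : ∀ {m n} (G : Graph (Fin n)) (F : Graph (Fin m)) (f : Fin m → Fin n) →
          Injective _≡_ _≡_ f →
          (∀ i j → Graph._~_ G (f i) (f j) ⇔ Graph._~_ F i j) →
          ∃ λ S → G [ S ] ≅ F
induced {n = n} G F f injective agree = S , record
  { bijection = mk↔ₛ′ (λ (_ , x∈S) → proj₁ (preimage x∈S)) (λ i → f i , image i)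
      (λ i → injective (proj₂ (preimage (image i))))
      (λ (_ , x∈S) → ∈-≡ (proj₂ (preimage x∈S)))
  ; adjacency = λ (_ , x∈S) (_ , y∈S) → transport (preimage x∈S) (preimage y∈S)
  }
  where
  open Graph G using (_~_)
  module F = Graph F
  transport : ∀ {x y} ((i , _) : ∃ λ i → f i ≡ x) ((j , _) : ∃ λ j → f j ≡ y) → (x ~ y) ⇔ (i F.~ j)
  transport (i , refl) (j , refl) = agree i j
  hit? : ∀ x → Dec (∃ λ i → f i ≡ x)
  hit? x = any? λ i → f i Fin.≟ x
  S : Subset n
  S = tabulate (does ∘ hit?)
  preimage : ∀ {x} → x ∈ S → ∃ λ i → f i ≡ x
  preimage {x} x∈S with hit? x | trans (sym (lookup∘tabulate (does ∘ hit?) x)) ([]=⇒lookup x∈S)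
  ... | yes hit | _ = hit
  image : ∀ i → f i ∈ S
  image i = lookup⇒[]= (f i) S (trans (lookup∘tabulate (does ∘ hit?) (f i)) (dec-true (hit? (f i)) (i , refl)))

private module P₆ = Graph (P 6)

-- Found by enumeration. As distinct vertices of P₆ have distinct neighbourhoods, a map into `G`
-- that preserves and reflects adjacency is automatically injective. A `path` leaf therefore needs
-- no proof that its six symbols denote different vertices.
P₆-twin-free : ∀ i j → (∀ k → (i P₆.~ k → j P₆.~ k) × (j P₆.~ k → i P₆.~ k)) → i ≡ j
P₆-twin-free = from-yes (all? λ i → all? λ j →
  all? (λ k → ((i P₆.~? k) →-dec (j P₆.~? k)) ×-dec ((j P₆.~? k) →-dec (i P₆.~? k)))
  →-dec (i Fin.≟ j))

P₆-map : ∀ {n} {G : Graph (Fin n)} → G is P 6 -free → (f : Fin 6 → Fin n) →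
         ¬ (∀ i j → Graph._~_ G (f i) (f j) ⇔ i P₆.~ j)
P₆-map {G = G} free f agree = free _ (proj₂ (induced G (P 6) f injective agree))
  where
  open Graph G using (_~_)
  injective : Injective _≡_ _≡_ f
  injective {i} {j} fi≡fj = P₆-twin-free i j λ k →
    Equivalence.to (agree j k) ∘ subst (_~ f k) fi≡fj ∘ Equivalence.from (agree i k) ,
    Equivalence.to (agree i k) ∘ subst (_~ f k) (sym fi≡fj) ∘ Equivalence.from (agree j k)

-- Cycles of the square, unrolled along the natural numbers.

module _ {n} (G : Graph (Fin n)) where
  open Graph G

  -- Disjoint closed neighbourhoods: distance at least 3 or different components. This covers both
  -- non-adjacent vertices of the cycle in the square and distinct members of `D`.
  Apart : Fin n → Fin n → Set
  Apart u v = ∀ z → Dominates G u z → Dominates G v z → ⊥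

  -- Index distances above 3 carry no information: at distance 4 the cycle C₅ has already closed up.
  record Unrolling : Set where
    field
      vertex : ℕ → Fin n
      link   : ∀ i → vertex i ~ vertex (1 + i) ⊎ ∃ λ z → vertex i ~ z × z ~ vertex (1 + i)
      apart₂ : ∀ i → Apart (vertex i) (vertex (2 + i))
      apart₃ : ∀ i → Apart (vertex i) (vertex (3 + i))

-- Refutations and their checker.

-- v i is the i-th vertex, d i its dominator, and x i the common neighbour of v i and v (1 + i); the latter is
-- the junk value v i when the unrolling supplies an edge instead.
data Sym : Set where
  v x d : ℕ → Sym

infix 4 _≟_
_≟_ : DecidableEquality Sym
v i ≟ v j = map′ (cong v) (λ { refl → refl }) (i ℕ.≟ j)
x i ≟ x j = map′ (cong x) (λ { refl → refl }) (i ℕ.≟ j)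
d i ≟ d j = map′ (cong d) (λ { refl → refl }) (i ℕ.≟ j)
v _ ≟ x _ = no λ ()
v _ ≟ d _ = no λ ()
x _ ≟ v _ = no λ ()
x _ ≟ d _ = no λ ()
d _ ≟ v _ = no λ ()
d _ ≟ x _ = no λ ()

data Fact : Set where
  edge nonedge apart : Sym → Sym → Fact
  centre             : Sym → Fact

infixr 1 if_∼_then_⨾_ if-linked_then_⨾_ if-centre_then_⨾_ _≠_via_⨾_ _∼_by_⨾_ _≁_by_⨾_

-- A refutation of a list of facts.  `path` and `clash` are its leaves: six symbols that induce a P₆, and two
-- that are both adjacent and non-adjacent.  `a ≠ b via c` records that the members a and b of D, told apart
-- by a ~ c and b ≁ c, have no common neighbour.  In `a ∼ b by p ⨾ q` the refutation p assumes a ≁ b.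
data Proof : Set where
  path              : (a b c e f g : Sym) → Proof
  clash             : (a b : Sym) → Proof
  if_∼_then_⨾_      : (a b : Sym) (p q : Proof) → Proof
  if-linked_then_⨾_ : (i : ℕ) (p q : Proof) → Proof
  if-centre_then_⨾_ : (i : ℕ) (p q : Proof) → Proof
  _≠_via_⨾_         : (a b c : Sym) (p : Proof) → Proof

_∼_by_⨾_ _≁_by_⨾_ : (a b : Sym) (p q : Proof) → Proof
a ∼ b by p ⨾ q = if a ∼ b then q ⨾ p
a ≁ b by p ⨾ q = if a ∼ b then p ⨾ q

every : ∀ {n} {A : Fin n → Set} → (∀ i → Maybe (A i)) → Maybe (∀ i → A i)
every {zero}  f = just λ ()
every {suc n} f = zipWith (λ { a as zero → a ; a as (suc i) → as i }) (f zero) (every (f ∘ suc))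

module Checker {n} {G : Graph (Fin n)} (free : G is P 6 -free)
  {D} (efficient : EfficientDominating G D) (u : Unrolling G) where

  open Graph G
  open Unrolling u

  dominator : Fin n → Fin n
  dominator z = proj₁ (efficient z)

  dominator-∈ : ∀ z → dominator z ∈ D
  dominator-∈ z = proj₁ (proj₁ (proj₂ (efficient z)))

  dominates : ∀ z → Dominates G (dominator z) z
  dominates z = proj₂ (proj₁ (proj₂ (efficient z)))

  ∈-unique : ∀ {a b z} → a ∈ D → b ∈ D → Dominates G a z → Dominates G b z → a ≡ b
  ∈-unique {z = z} a∈D b∈D a▷z b▷z =
    trans (sym (proj₂ (proj₂ (efficient z)) (a∈D , a▷z))) (proj₂ (proj₂ (efficient z)) (b∈D , b▷z))

  apart-centres : ∀ {a b} → a ∈ D → b ∈ D → a ≢ b → Apart G a b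
  apart-centres a∈D b∈D a≢b _ a▷z b▷z = a≢b (∈-unique a∈D b∈D a▷z b▷z)

  -- Domination is symmetric, so a common dominator of `y` and `z` would lie in both closed
  -- neighbourhoods. Hence the dominators are distinct members of `D`.
  apart-dominators : ∀ {y z} → Apart G y z → Apart G (dominator y) (dominator z)
  apart-dominators {y} {z} y#z = apart-centres (dominator-∈ y) (dominator-∈ z) λ eq →
    shared (dominates y) (subst (λ a → Dominates G a z) (sym eq) (dominates z))
    where
    flip : ∀ {a b} → Dominates G a b → Dominates G b a
    flip (inj₁ refl) = inj₁ refl
    flip (inj₂ a~b)  = inj₂ (~-sym a~b)
    shared : ∀ {a} → Dominates G a y → ¬ Dominates G a z
    shared a▷y a▷z = y#z _ (flip a▷y) (flip a▷z)

  Apart-sym : ∀ {y z} → Apart G y z → Apart G z y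
  Apart-sym y#z w z▷w y▷w = y#z w y▷w z▷w

  apart⇒nonadjacent : ∀ {y z} → Apart G y z → ¬ (y ~ z)
  apart⇒nonadjacent y#z y~z = y#z _ (inj₂ y~z) (inj₁ refl)

  neighbour⇒nonadjacent : ∀ {w y z} → w ~ y → Apart G y z → ¬ (w ~ z)
  neighbour⇒nonadjacent w~y y#z w~z = y#z _ (inj₂ (~-sym w~y)) (inj₂ (~-sym w~z))

  distinguished : ∀ {a b c} → a ∈ D → b ∈ D → a ~ c × ¬ (b ~ c) → Apart G a b
  distinguished a∈D b∈D (a~c , b≁c) = apart-centres a∈D b∈D λ { refl → b≁c a~c }

  ρ : Sym → Fin n
  ρ (v i) = vertex i
  ρ (x i) = [ (λ _ → vertex i) , proj₁ ]′ (link i)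
  ρ (d i) = dominator (vertex i)

  -- Adjacency is tested even when `link i` supplies a midpoint, so the second alternative carries
  -- the non-edge too. The junk value of `x i` never reaches it, since then `link i` is an edge.
  linked : ∀ i → vertex i ~ vertex (1 + i) ⊎
           ¬ (vertex i ~ vertex (1 + i)) × vertex i ~ ρ (x i) × ρ (x i) ~ vertex (1 + i)
  linked i with link i | vertex i ~? vertex (1 + i)
  ... | _                    | yes e = inj₁ e
  ... | inj₁ e               | no  _ = inj₁ e
  ... | inj₂ (_ , e₁ , e₂)   | no ¬e = inj₂ (¬e , e₁ , e₂)

  central : ∀ i → vertex i ∈ D ⊎ dominator (vertex i) ~ vertex i
  central i with dominates (vertex i)
  ... | inj₁ eq = inj₁ (subst (_∈ D) eq (dominator-∈ (vertex i)))
  ... | inj₂ e  = inj₂ e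

  Holds : Fact → Set
  Holds (edge a b)    = ρ a ~ ρ b
  Holds (nonedge a b) = ¬ (ρ a ~ ρ b)
  Holds (apart a b)   = Apart G (ρ a) (ρ b)
  Holds (centre a)    = ρ a ∈ D

  infix 2 _⊩_
  -- `Maybe` stands outside the function type: success of a derivation depends on symbols and facts
  -- alone. It thus computes for an abstract graph, and `from-just` can extract the proof.
  _⊩_ : List Fact → Set → Set
  Γ ⊩ A = Maybe (All Holds Γ → A)

  find : ∀ {A : Set} → (∀ F → Maybe (Holds F → A)) → ∀ Γ → Γ ⊩ A
  find test []      = nothing
  find test (F ∷ Γ) = Maybe.map (_∘ All.head) (test F) <∣> Maybe.map (_∘ All.tail) (find test Γ)

  same? : (a b : Sym) → Maybe (a ≡ b)
  same? a b = dec⇒maybe (a ≟ b)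

  oriented : {R : Sym → Sym → Set} → (∀ {a b} → R a b → R b a) → ∀ p q a b → Maybe (R p q → R a b)
  oriented R-sym p q a b =
    zipWith (λ { refl refl → id }) (same? p a) (same? q b) <∣>
    zipWith (λ { refl refl → R-sym }) (same? p b) (same? q a)

  edge? : ∀ Γ a b → Γ ⊩ ρ a ~ ρ b
  edge? Γ a b = find test Γ
    where
    test : ∀ F → Maybe (Holds F → ρ a ~ ρ b)
    test (edge p q) = oriented {λ s t → ρ s ~ ρ t} ~-sym p q a b
    test _          = nothing

  centre? : ∀ Γ a → Γ ⊩ ρ a ∈ D
  centre? _ (d i) = just λ _ → dominator-∈ (vertex i)
  centre? Γ a     = find test Γ
    where
    test : ∀ F → Maybe (Holds F → ρ a ∈ D)
    test (centre p) = Maybe.map (λ { refl → id }) (same? p a)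
    test _          = nothing

  close? : ∀ i j → Maybe (Apart G (vertex i) (vertex j))
  close? i j = ahead i j <∣> Maybe.map Apart-sym (ahead j i)
    where
    ahead : ∀ i j → Maybe (Apart G (vertex i) (vertex j))
    ahead i j = Maybe.map (λ { refl → apart₂ i }) (dec⇒maybe (j ℕ.≟ 2 + i)) <∣>
                Maybe.map (λ { refl → apart₃ i }) (dec⇒maybe (j ℕ.≟ 3 + i))

  apart? : ∀ Γ a b → Γ ⊩ Apart G (ρ a) (ρ b)
  apart? Γ a b = Maybe.map (λ p _ → p) (distant a b) <∣> find test Γ
    where
    distant : ∀ a b → Maybe (Apart G (ρ a) (ρ b))
    distant (v i) (v j) = close? i j
    distant (d i) (d j) = Maybe.map apart-dominators (close? i j)
    distant _     _     = nothing
    test : ∀ F → Maybe (Holds F → Apart G (ρ a) (ρ b))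
    test (apart p q) = oriented {λ s t → Apart G (ρ s) (ρ t)} Apart-sym p q a b
    test _           = nothing

  -- The sources of a non-edge are, in order: equal symbols, apartness, the hypotheses, and a
  -- neighbour of one symbol that is apart from the other.
  nonedge? : ∀ Γ a b → Γ ⊩ ¬ (ρ a ~ ρ b)
  nonedge? Γ a b =
    Maybe.map (λ { refl _ → irrefl refl }) (same? a b) <∣>
    Maybe.map (λ h γ → apart⇒nonadjacent (h γ)) (apart? Γ a b) <∣>
    find test Γ <∣>
    Maybe.map (λ h γ → h γ γ) (find (past a b) Γ) <∣>
    Maybe.map (λ h γ → h γ γ ∘ ~-sym) (find (past b a) Γ)
    where
    test : ∀ F → Maybe (Holds F → ¬ (ρ a ~ ρ b))
    test (nonedge p q) = oriented {λ s t → ¬ (ρ s ~ ρ t)} (_∘ ~-sym) p q a b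
    test _             = nothing
    past : ∀ a b F → Maybe (Holds F → All Holds Γ → ¬ (ρ a ~ ρ b))
    past a b (edge p q) =
      zipWith (λ { refl h a~q γ → neighbour⇒nonadjacent a~q (h γ) }) (same? p a) (apart? Γ q b) <∣>
      zipWith (λ { refl h p~a γ → neighbour⇒nonadjacent (~-sym p~a) (h γ) }) (same? q a) (apart? Γ p b)
    past a b _          = nothing

  path? : ∀ Γ (s : Vec Sym 6) → Γ ⊩ ⊥
  path? Γ s = Maybe.map (λ h γ → P₆-map {G = G} free (ρ ∘ lookup s) λ i j → h i j γ)
                        (every λ i → every λ j → agree i j)
    where
    agree : ∀ i j → Γ ⊩ ((ρ (lookup s i) ~ ρ (lookup s j)) ⇔ (i P₆.~ j))
    agree i j with i P₆.~? j
    ... | yes i~j = Maybe.map (λ h γ → mk⇔ (λ _ → i~j) (λ _ → h γ)) (edge? Γ (lookup s i) (lookup s j))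
    ... | no  i≁j = Maybe.map (λ h γ → mk⇔ (⊥-elim ∘ h γ) (⊥-elim ∘ i≁j)) (nonedge? Γ (lookup s i) (lookup s j))

  refute : ∀ Γ → Proof → Γ ⊩ ⊥
  refute Γ (path a b c e f g) = path? Γ (a ∷ b ∷ c ∷ e ∷ f ∷ g ∷ [])
  refute Γ (clash a b) = zipWith (λ f g γ → f γ (g γ)) (nonedge? Γ a b) (edge? Γ a b)
  refute Γ (if a ∼ b then p ⨾ q) =
    zipWith (λ f g γ → [ (λ e → f (e ∷ γ)) , (λ e → g (e ∷ γ)) ]′ (toSum (ρ a ~? ρ b)))
      (refute (edge a b ∷ Γ) p) (refute (nonedge a b ∷ Γ) q)
  refute Γ (if-linked i then p ⨾ q) =
    zipWith (λ f g γ → [ (λ e → f (e ∷ γ)) , (λ (e , e₁ , e₂) → g (e ∷ e₁ ∷ e₂ ∷ γ)) ]′ (linked i))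
      (refute (edge (v i) (v (1 + i)) ∷ Γ) p)
      (refute (nonedge (v i) (v (1 + i)) ∷ edge (v i) (x i) ∷ edge (x i) (v (1 + i)) ∷ Γ) q)
  refute Γ (if-centre i then p ⨾ q) =
    zipWith (λ f g γ → [ (λ e → f (e ∷ γ)) , (λ e → g (e ∷ γ)) ]′ (central i))
      (refute (centre (v i) ∷ Γ) p) (refute (edge (d i) (v i) ∷ Γ) q)
  refute Γ (a ≠ b via c ⨾ p) =
    zipWith (λ f h γ → f (h γ ∷ γ)) (refute (apart a b ∷ Γ) p)
      (zipWith (λ f g γ → f γ (g γ))
        (zipWith (λ f g γ → distinguished (f γ) (g γ)) (centre? Γ a) (centre? Γ b))
        (zipWith (λ f g γ → f γ , g γ) (edge? Γ a c) (nonedge? Γ b c)))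

-- The case distinctions.

v₀ v₁ v₂ v₃ v₄ v₅ x₀ x₁ x₂ x₃ x₄ d₀ d₁ d₂ d₃ d₄ d₅ : Sym
v₀ = v 0
v₁ = v 1
v₂ = v 2
v₃ = v 3
v₄ = v 4
v₅ = v 5
x₀ = x 0
x₁ = x 1
x₂ = x 2
x₃ = x 3
x₄ = x 4
d₀ = d 0
d₁ = d 1
d₂ = d 2
d₃ = d 3
d₄ = d 4
d₅ = d 5

-- Refutes v₁ ~ v₂ together with v₃ ~ v₄.
two-edges : Proof
two-edges =
  x₀ ∼ x₂ by path v₀ x₀ v₁ v₂ x₂ v₃ ⨾
  x₂ ∼ x₄ by path v₁ v₂ x₂ v₃ v₄ x₄ ⨾
  -- The next four pairs are beyond the reach of `apart₂` and `apart₃`, so each non-edge needs a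
  -- path of its own.
  x₀ ≁ x₄ by path v₂ v₁ x₀ x₄ v₄ v₃ ⨾
  v₀ ≁ x₄ by path v₁ x₀ v₀ x₄ v₄ v₃ ⨾
  v₅ ≁ x₀ by path v₁ x₀ v₅ x₄ v₄ v₃ ⨾
  v₀ ≁ v₅ by path v₀ v₅ x₄ x₂ v₂ v₁ ⨾
  -- The main cases concern domination of `v₄`: `v₄` is in `D`, `d₄` is adjacent to `x₀`, `d₄` is
  -- adjacent to `x₂`, or none of these.
  if-centre 4 then (
    if-centre 5 then (
      v₄ ≠ v₅ via v₃ ⨾
      clash v₅ x₄) ⨾
    d₅ ≠ v₄ via v₅ ⨾
    d₅ ≁ v₀ by path v₀ d₅ v₅ x₄ v₄ v₃ ⨾
    d₅ ≁ v₁ by path v₁ d₅ v₅ x₄ v₄ v₃ ⨾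
    d₅ ≁ x₀ by path v₃ v₄ x₄ v₅ d₅ x₀ ⨾
    d₅ ∼ x₂ by path d₅ v₅ x₄ x₂ v₂ v₁ ⨾
    if-centre 0 then (
      if-centre 1 then (
        v₁ ≠ v₀ via v₂ ⨾
        clash v₁ x₀) ⨾
      d₁ ≠ d₅ via v₁ ⨾
      d₁ ≠ v₀ via v₁ ⨾
      path d₁ v₁ x₀ x₂ v₃ v₄) ⨾
    d₀ ≠ d₅ via v₀ ⨾
    d₀ ≁ v₁ by path v₀ d₀ v₁ v₂ x₂ v₃ ⨾
    d₀ ∼ x₀ by path d₀ v₀ x₀ x₂ d₅ v₅ ⨾
    if-centre 1 then (
      v₁ ≠ d₀ via v₂ ⨾
      clash v₁ x₀) ⨾
    d₁ ≠ d₀ via v₁ ⨾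
    d₁ ≠ d₅ via v₁ ⨾
    path d₁ v₁ x₀ x₂ v₃ v₄) ⨾
  if d₄ ∼ x₀ then (
    d₄ ∼ v₃ by path v₂ v₁ x₀ d₄ v₄ v₃ ⨾
    d₄ ∼ x₄ by path v₂ v₁ x₀ d₄ v₄ x₄ ⨾
    path v₂ v₁ x₀ d₄ x₄ v₅) ⨾
  d₄ ≁ v₀ by path v₂ v₁ x₀ v₀ d₄ v₄ ⨾
  if d₄ ∼ x₂ then (
    if-centre 0 then (
      if-centre 1 then (
        v₁ ≠ v₀ via v₂ ⨾
        clash v₁ x₀) ⨾
      d₁ ≠ v₀ via v₁ ⨾
      d₁ ∼ x₀ by path d₁ v₁ x₀ x₂ d₄ v₄ ⨾
      clash d₁ x₀) ⨾
    d₀ ≠ d₄ via v₀ ⨾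
    d₀ ≁ v₁ by path v₀ d₀ v₁ v₂ x₂ v₃ ⨾
    d₀ ∼ x₀ by path d₀ v₀ x₀ x₂ v₃ v₄ ⨾
    if-centre 1 then (
      v₁ ≠ d₀ via v₂ ⨾
      clash v₁ x₀) ⨾
    d₁ ≠ d₀ via v₁ ⨾
    d₁ ∼ x₀ by path d₁ v₁ x₀ x₂ d₄ v₄ ⨾
    clash d₁ x₀) ⨾
  d₄ ∼ v₃ by path d₄ v₄ v₃ x₂ v₂ v₁ ⨾
  d₄ ∼ x₄ by path d₄ v₄ x₄ x₂ v₂ v₁ ⨾
  if-centre 5 then (
    d₄ ≠ v₅ via v₄ ⨾
    clash v₅ x₄) ⨾
  d₅ ≠ d₄ via v₅ ⨾
  d₅ ≁ v₀ by path v₀ d₅ v₅ x₄ v₄ v₃ ⨾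
  d₅ ≁ v₁ by path v₁ d₅ v₅ x₄ v₄ v₃ ⨾
  d₅ ∼ x₂ by path d₅ v₅ x₄ x₂ v₂ v₁ ⨾
  if-centre 0 then (
    if-centre 1 then (
      v₁ ≠ v₀ via v₂ ⨾
      clash v₁ x₀) ⨾
    d₁ ≠ d₅ via v₁ ⨾
    d₁ ≠ v₀ via v₁ ⨾
    path d₁ v₁ x₀ x₂ v₃ v₄) ⨾
  d₀ ≠ d₄ via v₀ ⨾
  d₀ ≠ d₅ via v₀ ⨾
  d₀ ≁ v₁ by path v₀ d₀ v₁ v₂ x₂ v₃ ⨾
  d₀ ∼ x₀ by path d₀ v₀ x₀ x₂ v₃ v₄ ⨾
  if-centre 1 then (
    v₁ ≠ d₀ via v₂ ⨾
    clash v₁ x₀) ⨾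
  d₁ ≠ d₀ via v₁ ⨾
  d₁ ≠ d₅ via v₁ ⨾
  path d₁ v₁ x₀ x₂ v₃ v₄

-- Refutes v₁ ~ v₂ when no other link is an edge.
lone-edge : Proof
lone-edge =
  x₀ ∼ x₂ by path v₀ x₀ v₁ v₂ x₂ v₃ ⨾
  x₂ ∼ x₃ by path v₁ v₂ x₂ v₃ x₃ v₄ ⨾
  v₀ ≁ v₄ by path v₀ v₄ x₃ x₂ v₂ v₁ ⨾
  x₂ ∼ x₄ by (
    x₃ ∼ x₄ by path v₁ v₂ x₂ x₃ v₄ x₄ ⨾
    path v₁ v₂ x₂ x₃ x₄ v₅) ⨾
  if-centre 3 then (
    if-centre 4 then (
      v₄ ≠ v₃ via x₄ ⨾
      clash v₄ x₃) ⨾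
    d₄ ≠ v₃ via v₄ ⨾
    path d₄ v₄ x₃ x₂ v₂ v₁) ⨾
  if-centre 4 then (
    d₃ ≠ v₄ via v₃ ⨾
    x₃ ∼ x₄ by path d₃ v₃ x₃ v₄ x₄ v₅ ⨾
    if-centre 5 then (
      v₄ ≠ v₅ via x₃ ⨾
      clash v₅ x₄) ⨾
    d₅ ≠ v₄ via v₅ ⨾
    path d₃ v₃ x₃ x₄ v₅ d₅) ⨾
  if d₃ ∼ v₂ then (
    d₃ ≠ d₄ via v₂ ⨾
    d₃ ∼ x₃ by path v₁ v₂ d₃ v₃ x₃ v₄ ⨾
    path d₄ v₄ x₃ d₃ v₂ v₁) ⨾
  if d₄ ∼ v₃ then (
    d₄ ≠ d₀ via v₃ ⨾
    d₄ ∼ x₂ by path v₁ v₂ x₂ v₃ d₄ v₄ ⨾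
    -- Here `d₃` and `d₄` both dominate `v₃`, so they are the same vertex. The language has no
    -- equality; a property of one is transferred to the other by refuting its negation.
    d₃ ∼ v₄ by (
      d₄ ≠ d₃ via v₄ ⨾
      clash d₄ v₃) ⨾
    d₃ ∼ x₂ by path v₁ v₂ x₂ v₃ d₃ v₄ ⨾
    if-centre 1 then (
      v₁ ≠ d₃ via v₂ ⨾
      if-centre 0 then (
        v₁ ≠ v₀ via v₂ ⨾
        clash v₁ x₀) ⨾
      d₀ ≠ v₁ via v₀ ⨾
      d₀ ∼ x₀ by path d₀ v₀ x₀ x₂ d₃ v₄ ⨾
      clash d₀ x₀) ⨾
    d₁ ∼ v₂ by path d₁ v₁ v₂ x₂ d₃ v₄ ⨾
    if-centre 0 then (
      d₁ ≠ v₀ via v₂ ⨾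
      d₃ ≠ v₀ via v₃ ⨾
      path d₁ v₁ x₀ x₂ d₃ v₄) ⨾
    d₀ ≠ d₁ via v₀ ⨾
    d₀ ≁ x₀ by path d₁ v₁ x₀ x₂ d₃ v₄ ⨾
    d₁ ∼ x₀ by path d₀ v₀ x₀ x₂ v₂ d₁ ⨾
    d₃ ∼ x₀ by path d₀ v₀ x₀ x₂ d₃ v₄ ⨾
    clash d₃ x₀) ⨾
  d₃ ≠ d₄ via v₃ ⨾
  d₄ ∼ x₂ by (
    d₄ ∼ x₃ by path d₄ v₄ x₃ x₂ v₂ v₁ ⨾
    d₄ ∼ x₄ by path d₄ v₄ x₄ x₂ v₂ v₁ ⨾
    d₄ ≁ v₅ by path v₁ v₂ x₂ x₃ d₄ v₅ ⨾
    x₃ ∼ x₄ by path d₃ v₃ x₃ v₄ x₄ v₅ ⨾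
    if-centre 5 then (
      d₄ ≠ v₅ via x₃ ⨾
      clash v₅ x₄) ⨾
    d₅ ≠ d₄ via v₅ ⨾
    path d₃ v₃ x₃ x₄ v₅ d₅) ⨾
  if-centre 1 then (
    v₁ ≠ d₃ via v₂ ⨾
    v₁ ≠ d₄ via v₂ ⨾
    d₄ ≁ v₀ by path v₂ v₁ x₀ v₀ d₄ v₄ ⨾
    if-centre 0 then (
      v₁ ≠ v₀ via v₂ ⨾
      clash v₁ x₀) ⨾
    d₀ ≠ d₄ via v₀ ⨾
    d₀ ≠ v₁ via v₀ ⨾
    path d₀ v₀ x₀ x₂ v₃ d₃) ⨾
  d₁ ∼ v₂ by path d₁ v₁ v₂ x₂ v₃ d₃ ⨾
  if-centre 0 then (
    d₁ ≠ v₀ via v₂ ⨾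
    d₃ ≠ v₀ via v₃ ⨾
    path d₁ v₁ x₀ x₂ v₃ d₃) ⨾
  d₀ ≠ d₁ via v₀ ⨾
  d₀ ≁ x₀ by path d₁ v₁ x₀ x₂ v₃ d₃ ⨾
  d₀ ≁ v₄ by path v₂ v₁ x₀ v₀ d₀ v₄ ⨾
  d₄ ≠ d₀ via v₄ ⨾
  d₁ ∼ x₀ by path d₀ v₀ x₀ x₂ v₂ d₁ ⨾
  d₃ ∼ x₀ by path d₀ v₀ x₀ x₂ v₃ d₃ ⨾
  clash d₃ x₀

-- Refutes v₁ ~ v₂.
edge-refutation : Proof
edge-refutation =
  -- An edge next to `v₁ ~ v₂` would give a walk of length 2 between vertices two indices apart, so
  -- links 0 and 2 have midpoints.
  if-linked 0 then clash v₀ v₁ ⨾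
  if-linked 2 then clash v₂ v₃ ⨾
  if-linked 3 then (
    if-linked 4 then clash v₄ v₅ ⨾
    two-edges) ⨾
  if-linked 4 then (
    x₂ ∼ x₃ by path v₁ v₂ x₂ v₃ x₃ v₄ ⨾
    path v₁ v₂ x₂ x₃ v₄ v₅) ⨾
  lone-edge

-- Refutes v₁ ∈ D in the absence of edges.
central-refutation : Proof
central-refutation =
  if-centre 0 then (
    v₁ ≠ v₀ via x₁ ⨾
    clash v₁ x₀) ⨾
  d₀ ≠ v₁ via v₀ ⨾
  x₀ ∼ x₁ by path d₀ v₀ x₀ v₁ x₁ v₂ ⨾
  if-centre 2 then (
    v₁ ≠ v₂ via x₀ ⨾
    clash v₂ x₁) ⨾
  d₂ ≠ v₁ via v₂ ⨾
  path d₀ v₀ x₀ x₁ v₂ d₂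

-- The remaining refutations are parametrised by symbols so that they can also be used back to front.

module _ (v₀ v₁ v₂ v₃ d₀ x₁ d₂ : Sym) where

  -- Refutes that d₀ is adjacent to both v₀ and v₁, and d₂ to both v₂ and v₃.
  two-shared : Proof
  two-shared =
    if d₀ ∼ x₁ then path v₀ d₀ x₁ v₂ d₂ v₃ ⨾
    x₁ ∼ d₂ by path v₀ d₀ v₁ x₁ v₂ d₂ ⨾
    path v₀ d₀ v₁ x₁ d₂ v₃

module _ (v₀ v₁ v₂ v₃ v₄ x₀ x₁ x₃ d₀ d₁ d₂ d₄ : Sym) where

  -- Refutes d₄ ≁ x₃ when d₂ is adjacent to both v₂ and v₃.
  beside-shared : Proof
  beside-shared =
    d₂ ∼ x₃ by path d₄ v₄ x₃ v₃ d₂ v₂ ⨾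
    if d₂ ∼ x₁ then (
      x₁ ∼ x₃ by path d₄ v₄ x₃ d₂ x₁ v₁ ⨾
      path d₁ v₁ x₁ x₃ v₄ d₄) ⨾
    d₀ ≁ x₁ by path v₀ d₀ x₁ v₂ d₂ v₃ ⨾
    x₁ ∼ x₃ by path v₁ x₁ v₂ d₂ x₃ v₄ ⨾
    if x₀ ∼ x₁ then (
      d₂ ∼ x₀ by path v₀ x₀ x₁ v₂ d₂ v₃ ⨾
      x₀ ∼ x₃ by path d₀ v₀ x₀ x₁ x₃ v₃ ⨾
      path d₁ v₁ x₀ x₃ v₄ d₄) ⨾
    d₂ ∼ x₀ by path v₃ d₂ v₂ x₁ v₁ x₀ ⨾
    d₀ ∼ x₀ by path d₀ v₀ x₀ v₁ x₁ v₂ ⨾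
    clash d₀ x₀

-- Refutes that d₂ is adjacent to both v₂ and v₃.
shared-refutation : Proof
shared-refutation =
  d₂ ≠ d₁ via v₃ ⨾
  d₀ ≁ v₁ by two-shared v₀ v₁ v₂ v₃ d₀ x₁ d₂ ⨾
  d₁ ≠ d₀ via v₁ ⨾
  -- Reversal exchanges `vᵢ` with `v₅₋ᵢ` and `xᵢ` with `x₄₋ᵢ`. As `d₂` dominates both `v₂` and `v₃`,
  -- it is its own mirror image.
  d₄ ≁ v₅ by two-shared v₅ v₄ v₃ v₂ d₄ x₃ d₂ ⨾
  d₅ ≠ d₄ via v₅ ⨾
  d₄ ∼ x₃ by beside-shared v₀ v₁ v₂ v₃ v₄ x₀ x₁ x₃ d₀ d₁ d₂ d₄ ⨾
  d₁ ∼ x₁ by beside-shared v₅ v₄ v₃ v₂ v₁ x₄ x₃ x₁ d₅ d₄ d₂ d₁ ⨾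
  if x₃ ∼ x₄ then (
    d₂ ∼ x₄ by path v₂ d₂ v₃ x₃ x₄ v₅ ⨾
    if x₀ ∼ x₁ then (
      d₂ ∼ x₀ by path v₀ x₀ x₁ v₂ d₂ v₃ ⨾
      x₀ ∼ x₄ by path d₄ v₄ x₄ d₂ x₀ v₁ ⨾
      path d₁ v₁ x₀ x₄ v₄ d₄) ⨾
    d₂ ∼ x₀ by path v₃ d₂ v₂ x₁ v₁ x₀ ⨾
    d₀ ∼ x₀ by path d₀ v₀ x₀ v₁ x₁ v₂ ⨾
    clash d₀ x₀) ⨾
  d₂ ∼ x₄ by path v₂ d₂ v₃ x₃ v₄ x₄ ⨾
  path d₄ x₃ v₃ d₂ x₄ v₅

module _ (v₀ v₁ v₂ v₃ x₀ x₁ x₂ d₀ d₁ d₂ d₃ : Sym) where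

  -- Refutes d₃ ~ x₀ for pairwise distinct successive dominators.
  far-midpoint : Proof
  far-midpoint =
    if d₃ ∼ x₁ then (
      x₀ ∼ x₁ by path d₀ v₀ x₀ v₁ x₁ v₂ ⨾
      path d₀ v₀ x₀ x₁ v₂ d₂) ⨾
    x₀ ∼ x₁ by path v₂ x₁ v₁ x₀ d₃ v₃ ⨾
    d₂ ∼ x₁ by path d₂ v₂ x₁ x₀ d₃ v₃ ⨾
    if d₁ ∼ x₂ then (
      x₀ ∼ x₂ by path v₀ x₀ v₁ d₁ x₂ v₂ ⨾
      path d₀ v₀ x₀ x₂ v₂ d₂) ⨾
    x₁ ∼ x₂ by path d₁ v₁ x₁ v₂ x₂ v₃ ⨾
    d₃ ∼ x₂ by path d₁ v₁ x₁ x₂ v₃ d₃ ⨾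
    d₀ ≁ x₂ by path d₁ v₁ x₁ x₂ d₀ v₀ ⨾
    x₀ ∼ x₂ by path d₁ v₁ x₀ d₃ x₂ v₂ ⨾
    path d₀ v₀ x₀ x₂ v₂ d₂

module _ (v₀ v₁ v₂ v₃ v₄ x₀ x₁ x₂ x₃ d₀ d₁ d₂ d₃ d₄ : Sym) where

  -- Refutes d₀ ≁ x₀ for pairwise distinct successive dominators.
  near-midpoint : Proof
  near-midpoint =
    -- The windows from `v₀` to `v₃` and from `v₁` to `v₄` are each read in both directions.
    d₃ ≁ x₀ by far-midpoint v₀ v₁ v₂ v₃ x₀ x₁ x₂ d₀ d₁ d₂ d₃ ⨾
    d₀ ≁ x₂ by far-midpoint v₃ v₂ v₁ v₀ x₂ x₁ x₀ d₃ d₂ d₁ d₀ ⨾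
    d₄ ≁ x₁ by far-midpoint v₁ v₂ v₃ v₄ x₁ x₂ x₃ d₁ d₂ d₃ d₄ ⨾
    d₁ ≁ x₃ by far-midpoint v₄ v₃ v₂ v₁ x₃ x₂ x₁ d₄ d₃ d₂ d₁ ⨾
    if d₃ ∼ x₁ then (
      x₀ ∼ x₁ by path v₀ x₀ v₁ x₁ d₃ v₃ ⨾
      path d₀ v₀ x₀ x₁ d₃ v₃) ⨾
    d₃ ∼ x₂ by (
      x₀ ≁ x₂ by path d₀ v₀ x₀ x₂ v₃ d₃ ⨾
      x₁ ∼ x₂ by path d₃ v₃ x₂ v₂ x₁ v₁ ⨾
      x₀ ∼ x₁ by path v₀ x₀ v₁ x₁ x₂ v₃ ⨾
      path d₃ v₃ x₂ x₁ x₀ v₀) ⨾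
    if d₀ ∼ x₃ then (
      x₂ ∼ x₃ by path v₀ d₀ x₃ v₃ x₂ v₂ ⨾
      path d₂ v₂ x₂ x₃ d₀ v₀) ⨾
    if d₃ ∼ x₃ then (
      x₂ ∼ x₃ by path d₄ v₄ x₃ v₃ x₂ v₂ ⨾
      path d₂ v₂ x₂ x₃ v₄ d₄) ⨾
    x₀ ≁ x₃ by path d₀ v₀ x₀ x₃ v₃ d₃ ⨾
    v₀ ≁ v₄ by path v₁ x₀ v₀ v₄ x₃ v₃ ⨾
    d₀ ≁ v₄ by path v₁ x₀ v₀ d₀ v₄ x₃ ⨾
    if d₁ ∼ x₁ then (
      x₀ ∼ x₁ by path d₀ v₀ x₀ v₁ x₁ v₂ ⨾
      d₂ ∼ x₀ by path d₀ v₀ x₀ x₁ v₂ d₂ ⨾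
      x₀ ∼ x₂ by path v₀ x₀ d₂ v₂ x₂ v₃ ⨾
      x₂ ∼ x₃ by path v₀ x₀ x₂ v₃ x₃ v₄ ⨾
      path d₀ v₀ x₀ x₂ x₃ v₄) ⨾
    x₁ ∼ x₂ by path d₁ v₁ x₁ v₂ x₂ v₃ ⨾
    x₁ ≁ x₃ by path d₁ v₁ x₁ x₃ v₃ d₃ ⨾
    x₂ ∼ x₃ by path v₁ x₁ x₂ v₃ x₃ v₄ ⨾
    path d₁ v₁ x₁ x₂ x₃ v₄

-- Excluding unrollings stage by stage.

module _ {n} {G : Graph (Fin n)} where

  open Unrolling

  tail : Unrolling G → Unrolling G
  tail u = record
    { vertex = vertex u ∘ suc
    ; link   = link u ∘ suc
    ; apart₂ = apart₂ u ∘ suc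
    ; apart₃ = apart₃ u ∘ suc
    }

  -- With `m` added on the right, `(1 + i) + m` reduces to `1 + (i + m)`, so the fields carry over
  -- without transport.
  shift : ℕ → Unrolling G → Unrolling G
  shift m u = record
    { vertex = vertex u ∘ (_+ m)
    ; link   = link u ∘ (_+ m)
    ; apart₂ = apart₂ u ∘ (_+ m)
    ; apart₃ = apart₃ u ∘ (_+ m)
    }

module _ {n} {G : Graph (Fin n)} (free : G is P 6 -free)
  {D} (efficient : EfficientDominating G D) where

  open Graph G
  open Unrolling using (vertex)
  open module Check (u : Unrolling G) = Checker {G = G} free efficient u

  no-edge : ∀ u → ¬ (vertex u 1 ~ vertex u 2)
  no-edge u e = from-just (refute u (edge v₁ v₂ ∷ []) edge-refutation) (e ∷ [])

  Spread Outer Private : Unrolling G → Set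
  Spread u  = ∀ i → ¬ (vertex u i ~ vertex u (1 + i)) × vertex u i ~ ρ u (x i) × ρ u (x i) ~ vertex u (1 + i)
  Outer u   = ∀ i → ρ u (d i) ~ vertex u i
  Private u = ∀ i → ¬ (ρ u (d i) ~ vertex u (1 + i))

  spread-facts outer-facts private-facts : ℕ → List Fact
  spread-facts  i = nonedge (v i) (v (1 + i)) ∷ edge (v i) (x i) ∷ edge (x i) (v (1 + i)) ∷ []
  outer-facts   i = edge (d i) (v i) ∷ spread-facts i
  private-facts i = nonedge (d i) (v (1 + i)) ∷ apart (d (1 + i)) (d i) ∷ outer-facts i

  spread-hold : ∀ u → Spread u → ∀ i → All (Holds u) (spread-facts i)
  spread-hold u spread i = let ¬e , e₁ , e₂ = spread i in ¬e ∷ e₁ ∷ e₂ ∷ []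

  outer-hold : ∀ u → Spread u → Outer u → ∀ i → All (Holds u) (outer-facts i)
  outer-hold u spread outer i = outer i ∷ spread-hold u spread i

  -- `Private` only looks forward. Apartness is symmetric and, with `Outer`, also makes `d (1 + i)`
  -- non-adjacent to `v i`, as the reversed refutations require.
  apart-successive : ∀ u → Outer u → Private u → ∀ i → Holds u (apart (d (1 + i)) (d i))
  apart-successive u outer private′ i =
    distinguished u (dominator-∈ u _) (dominator-∈ u _) (outer (1 + i) , private′ i)

  private-hold : ∀ u → Spread u → Outer u → Private u → ∀ i → All (Holds u) (private-facts i)
  private-hold u spread outer private′ i =
    private′ i ∷ apart-successive u outer private′ i ∷ outer-hold u spread outer i

  window : ∀ u {f : ℕ → List Fact} → (∀ i → All (Holds u) (f i)) → ∀ k → All (Holds u) (concatMap f (upTo k))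
  window u hold k = All.concat⁺ (All.map⁺ (All.universal hold (upTo k)))

  spread-tail : ∀ u → Spread (tail u)
  spread-tail u i with linked (tail u) i
  ... | inj₁ e      = ⊥-elim (no-edge (shift i u) e)
  ... | inj₂ spread = spread

  not-central : ∀ u → Spread u → ¬ (vertex u 1 ∈ D)
  not-central u spread c = from-just
    (refute u (centre v₁ ∷ concatMap spread-facts (upTo 3)) central-refutation)
    (c ∷ window u (spread-hold u spread) 3)

  outer-tail : ∀ u → Spread u → Outer (tail u)
  outer-tail u spread i with central (tail u) i
  ... | inj₁ c = ⊥-elim (not-central (shift i u) (λ j → spread (j + i)) c)
  ... | inj₂ e = e

  not-shared : ∀ u → Spread u → Outer u → ¬ (ρ u (d 2) ~ vertex u 3)
  not-shared u spread outer e = from-just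
    (refute u (edge d₂ v₃ ∷ concatMap outer-facts (upTo 6)) shared-refutation)
    (e ∷ window u (outer-hold u spread outer) 6)

  private-tail : ∀ u → Spread u → Outer u → Private (tail (tail u))
  private-tail u spread outer i = not-shared (shift i u) (λ j → spread (j + i)) (λ j → outer (j + i))

  near-right : ∀ u → Spread u → Outer u → Private u → ρ u (d 0) ~ ρ u (x 0)
  near-right u spread outer private′ = decidable-stable (_ ~? _) λ ¬e → from-just
    (refute u (nonedge d₀ x₀ ∷ concatMap private-facts (upTo 5))
      (near-midpoint v₀ v₁ v₂ v₃ v₄ x₀ x₁ x₂ x₃ d₀ d₁ d₂ d₃ d₄))
    (¬e ∷ window u (private-hold u spread outer private′) 5)

  near-left : ∀ u → Spread u → Outer u → Private u → ρ u (d 4) ~ ρ u (x 3)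
  near-left u spread outer private′ = decidable-stable (_ ~? _) λ ¬e → from-just
    (refute u (nonedge d₄ x₃ ∷ concatMap private-facts (upTo 5))
      (near-midpoint v₄ v₃ v₂ v₁ v₀ x₃ x₂ x₁ x₀ d₄ d₃ d₂ d₁ d₀))
    (¬e ∷ window u (private-hold u spread outer private′) 5)

  not-private : ∀ u → Spread u → Outer u → ¬ Private u
  -- The forbidden common neighbour of `d₄` and `d₃` is `x₃`: the window starting at 0 and read
  -- backwards gives `d₄ ~ x₃`, the one starting at 3 gives `d₃ ~ x₃`.
  not-private u spread outer private′ = apart-successive u outer private′ 3 _
    (inj₂ (near-left u spread outer private′))
    (inj₂ (near-right (shift 3 u) (λ j → spread (j + 3)) (λ j → outer (j + 3)) (λ j → private′ (j + 3))))

  no-unrolling : ¬ Unrolling G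
  no-unrolling u =
    -- Each stage holds only from the index on which its refutation acts, namely 1, 1 and 2, so four
    -- initial terms are dropped in all.
    not-private (tail (tail u′)) (λ i → spread (2 + i)) (λ i → outer (2 + i)) (private-tail u′ spread outer)
    where
    u′ = tail (tail u)
    spread : Spread u′
    spread i = spread-tail u (suc i)
    outer : Outer u′
    outer = outer-tail (tail u) (spread-tail u)

-- From an induced cycle of the square to an unrolling.

apart-vertices : ∀ {n} (G : Graph (Fin n)) {y z} → y ≢ z → ¬ Graph._~_ (G ²) y z → Apart G y z
apart-vertices G y≢z ¬y~z w (inj₁ refl) (inj₁ refl) = y≢z refl
apart-vertices G y≢z ¬y~z w (inj₁ refl) (inj₂ z~y)  = ¬y~z (inj₁ (distance₁⁺ G (Graph.~-sym G z~y)))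
apart-vertices G y≢z ¬y~z w (inj₂ y~z) (inj₁ refl)  = ¬y~z (inj₁ (distance₁⁺ G y~z))
apart-vertices G {y} {z} y≢z ¬y~z w (inj₂ y~w) (inj₂ z~w) with Graph._~?_ G y z
... | yes y~z = ¬y~z (inj₁ (distance₁⁺ G y~z))
... | no  y≁z = ¬y~z (inj₂ (distance₂⁺ G (y≢z , y≁z , w , y~w , Graph.~-sym G z~w)))

module _ {k} .{{_ : NonZero k}} where

  suc-% : ∀ i → suc i % k ≡ suc (i % k) % k
  suc-% i = trans (cong (λ j → suc j % k) (m≡m%n+[m/n]*n i k)) ([m+kn]%n≡m%n (suc (i % k)) (i / k) k)

  toℕ-mod : ∀ i → toℕ (i mod k) ≡ i % k
  toℕ-mod i = Fin.toℕ-fromℕ< (m%n<n i k)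

  next-mod : ∀ i → Next (i mod k) (suc i mod k)
  next-mod i rewrite toℕ-mod i | toℕ-mod (suc i) | suc-% i with ℕ.m≤n⇒m<n∨m≡n (m%n<n i k)
  ... | inj₁ lt = inj₁ (sym (m<n⇒m%n≡m lt))
  ... | inj₂ eq = inj₂ (eq , trans (cong (_% k) eq) (n%n≡0 k))

  next-mod⁻ : ∀ i j → Next (i mod k) (j mod k) → suc i % k ≡ j % k
  next-mod⁻ i j next rewrite toℕ-mod i | toℕ-mod j | suc-% i with next
  ... | inj₁ eq        = trans (cong (_% k) eq) (m%n%n≡m%n j k)
  ... | inj₂ (eq , eq₀) = trans (cong (_% k) eq) (trans (n%n≡0 k) (sym eq₀))

  -- Equal residues would make `k` divide `g`, which lies strictly between 0 and `k`.
  %-offset : ∀ g i → .{{NonZero g}} → g < k → ¬ ((g + i) % k ≡ i % k)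
  %-offset g i g<k eq = >⇒∤ g<k (∣m+n∣m⇒∣n {n = g} (divides ((g + i) / k) lem) (divides (i / k) refl))
    where
    open ≡-Reasoning
    lem : (i / k) * k + g ≡ ((g + i) / k) * k
    lem = ℕ.+-cancelˡ-≡ (i % k) _ _ (begin
      i % k + (i / k * k + g)           ≡⟨ ℕ.+-assoc (i % k) _ g ⟨
      i % k + i / k * k + g             ≡⟨ cong (_+ g) (m≡m%n+[m/n]*n i k) ⟨
      i + g                             ≡⟨ ℕ.+-comm i g ⟩
      g + i                             ≡⟨ m≡m%n+[m/n]*n (g + i) k ⟩
      (g + i) % k + (g + i) / k * k     ≡⟨ cong (_+ (g + i) / k * k) eq ⟩
      i % k + (g + i) / k * k           ∎)

unroll : ∀ {n} (G : Graph (Fin n)) {k} (5≤k : 5 ≤ k) {S : Subset n} →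
         (G ²) [ S ] ≅ C k (≤-trans (m≤m+n 3 2) 5≤k) → Unrolling G
unroll {n} G {k@(suc _)} 5≤k {S} iso = record
  { vertex = vertex
  ; link   = λ i → link (adjacent (inj₁ (next-mod i)))
  ; apart₂ = spaced 1 (ℕ.≤-trans (ℕ.m≤m+n 4 1) 5≤k)
  ; apart₃ = spaced 2 5≤k
  }
  where
  open _≅_ iso
  open Inverse bijection using (to; from; strictlyInverseˡ)
  open Graph (G ²)
  module C = Graph (C k (≤-trans (m≤m+n 3 2) 5≤k))

  vertex : ℕ → Fin n
  vertex i = proj₁ (from (i mod k))

  from-injective : ∀ {a b} → proj₁ (from a) ≡ proj₁ (from b) → a ≡ b
  from-injective {a} {b} eq =
    trans (sym (strictlyInverseˡ a)) (trans (cong to (∈-≡ eq)) (strictlyInverseˡ b))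

  adjacency′ : ∀ a b → (proj₁ (from a) ~ proj₁ (from b)) ⇔ (a C.~ b)
  adjacency′ a b = subst₂ (λ a′ b′ → (proj₁ (from a) ~ proj₁ (from b)) ⇔ (a′ C.~ b′))
    (strictlyInverseˡ a) (strictlyInverseˡ b) (adjacency (from a) (from b))

  adjacent : ∀ {a b} → a C.~ b → proj₁ (from a) ~ proj₁ (from b)
  adjacent = Equivalence.from (adjacency′ _ _)

  link : ∀ {y z} → y ~ z → Graph._~_ G y z ⊎ ∃ λ w → Graph._~_ G y w × Graph._~_ G w z
  link (inj₁ dist) = inj₁ (distance₁⁻ G dist)
  link (inj₂ dist) = inj₂ (proj₂ (proj₂ (distance₂⁻ G dist)))

  -- The index gap is `1 + g`. Coincidence, or adjacency in either direction round the cycle, would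
  -- make `k` divide `1 + g`, `g` or `2 + g`, all positive and below `k`. For gap 3 the bound is
  -- exactly `5 ≤ k`.
  spaced : ∀ g .{{_ : NonZero g}} → 2 + g < k → ∀ i → Apart G (vertex i) (vertex (1 + g + i))
  spaced g 2+g<k i = apart-vertices G distinct λ y~z → nonadjacent (Equivalence.to (adjacency′ _ _) y~z)
    where
    distinct : vertex i ≢ vertex (1 + g + i)
    distinct eq = %-offset (1 + g) i (ℕ.<-trans (ℕ.n<1+n _) 2+g<k)
      (sym (trans (sym (toℕ-mod i)) (trans (cong toℕ (from-injective eq)) (toℕ-mod (1 + g + i)))))
    nonadjacent : ¬ ((i mod k) C.~ ((1 + g + i) mod k))
    nonadjacent (inj₁ next) = %-offset g (suc i) (ℕ.<-trans (ℕ.n<1+n g) (ℕ.<-trans (ℕ.n<1+n _) 2+g<k))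
      (sym (trans (next-mod⁻ i (1 + g + i) next) (cong (_% k) (sym (ℕ.+-suc g i)))))
    nonadjacent (inj₂ next) = %-offset (2 + g) i 2+g<k (next-mod⁻ (1 + g + i) i next)

theorem2 : ∀ (n : ℕ) (G : Graph (Fin n)) → G is P 6 -free → ∃ (λ D → EfficientDominating G D) →
    ∀ (k : ℕ) (5≤k : 5 ≤ k) → G ² is C k (≤-trans (m≤m+n 3 2) 5≤k) -free
theorem2 n G free (D , efficient) k 5≤k S iso = no-unrolling free efficient (unroll G 5≤k iso)
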